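{- Let $\mathcal{B}$ be a Turing-complete basis of primitive combinators. Let $\mathcal{WN}_{\mathcal{B}}\subseteq \mathcal{C}_{\mathcal{B}}$ be the set of (weakly) normalising $\mathcal{B}$-combinators. Then $$0<\mu^{ - }\!\left(\frac{\mathcal{WN}_{\mathcal{B}}}{\mathcal{C}_{\mathcal{B}}}\right)\quad\text{and}\quad \mu^{+}\!\left(\frac{\mathcal{WN}_{\mathcal{B}}}{\mathcal{C}_{\mathcal{B}}}\right)<1 .$$
   Context: Combinators. Let $\mathcal{B}$ be a finite basis of primitive combinators. The set $\mathcal{C}_{\mathcal{B}}$ of $\mathcal{B}$-combinators is the smallest set containing $\mathcal{B}$ and closed under application $(N,M)\mapsto (NM)$; application associates to the left. The size $|P|$ is the number of applications in $P$. Reduction. Each primitive $\mathbf{X}\in\mathcal{B}$ comes with one reduction rule $\mathbf{X}N_1\ldots N_m\to M$ with $m\ge 1$, where $N_1,\ldots,N_m$ are arbitrary combinators and $M$ is a fixed term built from $N_1,\ldots,N_m$ by application. The relation is extended so that $P\to Q$ implies $PR\to QR$ and $RP\to RQ$ for every combinator $R$. $P$ is in normal form if there is no $Q$ with $P\to Q$. $P$ is (weakly) normalising if there is a finite sequence $P=P_0\to P_1\to\cdots\to P_k$ with $P_k$ in normal form. Turing-completeness. $\mathcal{B}$ is Turing-complete if there are $\mathcal{B}$-combinators extensionally equivalent to $\mathbf{S}$ and to $\mathbf{K}$, where $\mathbf{S}xyz\to xz(yz)$ and $\mathbf{K}xy\to x$. Here a $\mathcal{B}$-combinator $N$ is extensionally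 equivalent to $\mathbf{S}$ (resp. $\mathbf{K}$) if, over terms built from $\mathcal{B}$ and fresh variables $x,y,z$, $Nxyz$ is convertible to $xz(yz)$ (resp. $Nxy$ is convertible to $x$), convertibility being the equivalence relation generated by $\to$. Densities. For $A\subseteq B$ with $a_n$, $b_n$ the numbers of elements of size $n$ in $A$, $B$: $\mu^{ - }\left(\frac{A}{B}\right)=\liminf_{n\to\infty} a_n/b_n$ and $\mu^{+}\left(\frac{A}{B}\right)=\limsup_{n\to\infty}a_n/b_n$. -}

module Defs where

open import Data.Empty using (⊥)
open import Data.Fin.Base using (Fin)
open import Data.Integer.Base using (+_)
open import Data.List.Base using (List; []; _∷_; _++_; length; map; allFin; cartesianProductWith)
open import Data.List.Membership.Propositional using (_∈_)
open import Data.List.Membership.Propositional.Properties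
  using (∈-map⁺; ∈-allFin; ∈-++⁺ˡ; ∈-++⁺ʳ; ∈-cartesianProductWith⁺)
open import Data.List.Relation.Unary.All using (tabulate)
open import Data.List.Relation.Unary.AllPairs using ([]; _∷_)
open import Data.List.Relation.Unary.Any using (here; there)
open import Data.List.Relation.Unary.Unique.Propositional using (Unique)
open import Data.Nat.Base using (ℕ; zero; suc; _+_; _≤_; _≥_; s≤s⁻¹; NonZero)
open import Data.Nat.Properties using (≤-refl; ≤-trans; ≤-reflexive; m≤m+n; m≤n+m; +-identityʳ)
open import Data.Product.Base using (∃; ∃-syntax; Σ-syntax; _×_; _,_)
open import Data.Rational.Base as ℚ using (ℚ)
open import Data.Unit.Base using (tt)
open import Data.Vec.Base using (Vec; lookup; foldl)
open import Function.Bundles using (_⇔_; mk⇔; Equivalence)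
open import Level using (0ℓ)
open import Relation.Binary.Construct.Closure.Equivalence using (EqClosure)
open import Relation.Binary.PropositionalEquality using (_≡_; refl; cong)
open import Relation.Binary.Rewriting using (HasNormalForm)
open import Relation.Nullary.Decidable.Core using (yes; no; ¬¬-excluded-middle)
open import Relation.Nullary.Negation.Core using (¬_; contradiction)
open import Relation.Unary using (Pred; U)

infixl 7 _·_

-- The right-hand side M of a rule X N₁ … Nₘ → M: it contains no primitives,
-- only applications of the arguments Nᵢ.
data RHS (m : ℕ) : Set where
  arg : Fin m → RHS m
  _·_ : RHS m → RHS m → RHS m

record Basis : Set where
  field
    #primitives : ℕ

  Primitive : Set
  Primitive = Fin #primitives

  field
    arity   : Primitive → ℕ
    arity≥1 : ∀ X → arity X ≥ 1
    rhs     : (X : Primitive) → RHS (arity X)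

module _ (𝓑 : Basis) where
  open Basis 𝓑

  infixl 7 _·_

  -- Terms over the basis and variables from V.
  data Term (V : Set) : Set where
    prim : Primitive → Term V
    var  : V → Term V
    _·_  : Term V → Term V → Term V

  Combinator : Set
  Combinator = Term ⊥

module _ {𝓑 : Basis} where
  open Basis 𝓑

  size : {V : Set} → Term 𝓑 V → ℕ
  size (prim X) = 0
  size (var v)  = 0
  size (P · Q)  = suc (size P + size Q)

  applyAll : {V : Set} {m : ℕ} → Term 𝓑 V → Vec (Term 𝓑 V) m → Term 𝓑 V
  applyAll {V} P Ns = foldl (λ _ → Term 𝓑 V) _·_ P Ns

  instantiate : {V : Set} {m : ℕ} → RHS m → Vec (Term 𝓑 V) m → Term 𝓑 V
  instantiate (arg i) Ns = lookup Ns i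
  instantiate (M · N) Ns = instantiate M Ns · instantiate N Ns

  infix 4 _⟶_ _↔_

  data _⟶_ {V : Set} : Term 𝓑 V → Term 𝓑 V → Set where
    rule : (X : Primitive) (Ns : Vec (Term 𝓑 V) (arity X)) →
           applyAll (prim X) Ns ⟶ instantiate (rhs X) Ns
    appˡ : ∀ {P Q} R → P ⟶ Q → P · R ⟶ Q · R
    appʳ : ∀ {P Q} R → P ⟶ Q → R · P ⟶ R · Q

  _↔_ : {V : Set} → Term 𝓑 V → Term 𝓑 V → Set
  _↔_ = EqClosure _⟶_

  -- A combinator regarded as a term with (unused) variables.
  embed : {V : Set} → Combinator 𝓑 → Term 𝓑 V
  embed (prim X) = prim X
  embed (P · Q)  = embed P · embed Q

data Variable : Set where
  x y z : Variable

module _ (𝓑 : Basis) where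

  ExtEqS : Combinator 𝓑 → Set
  ExtEqS N = embed N · var x · var y · var z ↔ var x · var z · (var y · var z)

  ExtEqK : Combinator 𝓑 → Set
  ExtEqK N = embed N · var x · var y ↔ var x

  TuringComplete : Set
  TuringComplete = ∃ ExtEqS × ∃ ExtEqK

  𝒞 : Pred (Combinator 𝓑) 0ℓ
  𝒞 = U

  𝒲𝒩 : Pred (Combinator 𝓑) 0ℓ
  𝒲𝒩 = HasNormalForm _⟶_

-- Membership in 𝒲𝒩 is undecidable, so the number of its elements of size n is
-- not available as a function of n. Sequences are therefore given by their
-- graphs: s n q says that the n-th term of s is q.
RatioSeq : Set₁
RatioSeq = ℕ → Pred ℚ 0ℓ

module _ {𝓑 : Basis} where

  Count : Pred (Combinator 𝓑) 0ℓ → ℕ → ℕ → Set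
  Count A n a = Σ[ Ps ∈ List (Combinator 𝓑) ]
    Unique Ps × (∀ P → P ∈ Ps ⇔ (A P × size P ≡ n)) × length Ps ≡ a

  -- The sequence aₙ / bₙ.
  ratio : (A B : Pred (Combinator 𝓑) 0ℓ) → RatioSeq
  ratio A B n q = ∃[ a ] ∃[ b ] Σ[ nz ∈ NonZero b ]
    Count A n a × Count B n b × q ≡ ℚ._/_ (+ a) b {{nz}}

-- liminf s = sup_N inf_{n ≥ N} sₙ is given by its lower Dedekind cut and
-- limsup s = inf_N sup_{n ≥ N} sₙ by its upper cut. A rational q is strictly
-- below the infimum of a set iff some rational r > q is a lower bound of it.
infix 4 _<liminf_ limsup_<_

_<liminf_ : ℚ → RatioSeq → Set
q <liminf s = ∃[ N ] ∃[ r ] q ℚ.< r × (∀ n → n ≥ N → ∀ t → s n t → r ℚ.≤ t)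

limsup_<_ : RatioSeq → ℚ → Set
limsup s < q = ∃[ N ] ∃[ r ] r ℚ.< q × (∀ n → n ≥ N → ∀ t → s n t → t ℚ.≤ r)

-- Over a nonempty basis no term of the sequence aₙ / |𝒞ₙ| can be missing, so
-- the bounds above are not vacuous. The double negation reflects the
-- undecidability of A.
module _ {𝓑 : Basis} where
  open Basis 𝓑

  private
    upTo : ℕ → List (Combinator 𝓑)
    upTo zero    = map prim (allFin #primitives)
    upTo (suc n) = map prim (allFin #primitives) ++ cartesianProductWith _·_ (upTo n) (upTo n)

    ∈-upTo : ∀ n P → size P ≤ n → P ∈ upTo n
    ∈-upTo zero    (prim X) _ = ∈-map⁺ prim (∈-allFin X)
    ∈-upTo (suc n) (prim X) _ = ∈-++⁺ˡ (∈-map⁺ prim (∈-allFin X))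
    ∈-upTo (suc n) (P · Q) le = ∈-++⁺ʳ (map prim (allFin #primitives))
      (∈-cartesianProductWith⁺ _·_
        (∈-upTo n P (≤-trans (m≤m+n (size P) (size Q)) (s≤s⁻¹ le)))
        (∈-upTo n Q (≤-trans (m≤n+m (size Q) (size P)) (s≤s⁻¹ le))))

    enumerate : (A : Pred (Combinator 𝓑) 0ℓ) (Ps : List (Combinator 𝓑)) →
      ¬ ¬ (Σ[ Qs ∈ List (Combinator 𝓑) ] Unique Qs × (∀ P → P ∈ Qs ⇔ (A P × P ∈ Ps)))
    enumerate A []       k = k ([] , [] , λ P → mk⇔ (λ ()) (λ { (_ , ()) }))
    enumerate A (R ∷ Ps) k = enumerate A Ps λ { (Qs , uniq , char) →
      let to   = λ {P} → Equivalence.to (char P)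
          from = λ {P} → Equivalence.from (char P)
          keep : ∀ {P} → P ∈ Qs → A P × P ∈ R ∷ Ps
          keep P∈Qs = let (aP , P∈Ps) = to P∈Qs in aP , there P∈Ps
      in ¬¬-excluded-middle λ
        { (yes R∈Qs) → k (Qs , uniq , λ P → mk⇔ keep
            λ { (_ , here refl) → R∈Qs ; (aP , there P∈Ps) → from (aP , P∈Ps) })
        ; (no R∉Qs) → ¬¬-excluded-middle λ
          { (yes aR) → k (R ∷ Qs
              , tabulate (λ { Q∈Qs refl → R∉Qs Q∈Qs }) ∷ uniq
              , λ P → mk⇔ (λ { (here refl) → aR , here refl ; (there P∈Qs) → keep P∈Qs })
                  λ { (_ , here refl) → here refl ; (aP , there P∈Ps) → there (from (aP , P∈Ps)) })
          ; (no ¬aR) → k (Qs , uniq , λ P → mk⇔ keep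
              λ { (aR , here refl) → contradiction aR ¬aR ; (aP , there P∈Ps) → from (aP , P∈Ps) }) } } }

    ofSize : Primitive → ℕ → Combinator 𝓑
    ofSize X zero    = prim X
    ofSize X (suc n) = ofSize X n · prim X

    size-ofSize : ∀ X n → size (ofSize X n) ≡ n
    size-ofSize X zero    = refl
    size-ofSize X (suc n) rewrite +-identityʳ (size (ofSize X n)) = cong suc (size-ofSize X n)

    ∈⇒nonZero : {P : Combinator 𝓑} {Ps : List (Combinator 𝓑)} → P ∈ Ps → NonZero (length Ps)
    ∈⇒nonZero (here _)  = _
    ∈⇒nonZero (there _) = _

  count-defined : ∀ A n → ¬ ¬ (∃[ a ] Count A n a)
  count-defined A n k = enumerate (λ P → A P × size P ≡ n) (upTo n) λ { (Ps , uniq , char) →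
    k (length Ps , Ps , uniq
      , (λ P → mk⇔ (λ P∈ → let (aP , _) = Equivalence.to (char P) P∈ in aP)
                   (λ { (aP , eq) → Equivalence.from (char P)
                          ((aP , eq) , ∈-upTo n P (≤-reflexive eq)) }))
      , refl) }

  ratio-defined : Primitive → ∀ A n → ¬ ¬ (∃[ q ] ratio A (𝒞 𝓑) n q)
  ratio-defined X A n k =
    count-defined A n λ { (a , countA) →
    count-defined (𝒞 𝓑) n λ { (_ , Ps , uniq , char , refl) →
      let nz = ∈⇒nonZero (Equivalence.from (char (ofSize X n)) (tt , size-ofSize X n))
      in k (_ , a , length Ps , nz , countA , (Ps , uniq , char , refl) , refl) } }

{-# OPTIONS --safe #-}
module Submission where

-- For a fixed combinator F of size s, the terms F Q of size n correspond to all
-- the terms Q of size n - s - 1. The number c n of combinators of size n satisfies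
-- the Catalan recurrence (n + 2) c (n + 1) = r (4 n + 2) c n with r primitives, so
-- c (n + 1) ≤ 4 r c n, and the terms F Q have density at least (4 r)^-(s + 1).
-- It remains to find F such that all F Q are normalising, and F such that none is.
-- For a combinator K with K x y convertible to x, these are K X with X primitive
-- and K Ω with Ω = (S I I) (S I I), I = S K K. An arbitrary basis gives no control
-- over how S x y z reduces to x z (y z), and an infinite reduction of Ω alone does
-- not exclude a normal form. By standardisation, however, the reduction can be
-- taken to be a head reduction followed by head reductions of the arguments; this
-- makes the head reduction of K Ω Q infinite, which a normalising term does not allow.

open import Defs
open import Data.Empty using (⊥)
import Data.Integer.Base as ℤ
import Data.Integer.Properties as ℤ
open import Data.List.Base using (List; []; _∷_; _++_; length; map; allFin; cartesianProductWith)
open import Data.List.Membership.Propositional using (_∈_)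
open import Data.List.Membership.Propositional.Properties
open import Data.List.Properties using (length-++; length-map)
open import Data.List.Relation.Binary.Disjoint.Propositional using (Disjoint)
open import Data.List.Relation.Binary.Subset.Propositional using (_⊆_)
import Data.List.Relation.Unary.All as All
open import Data.List.Relation.Unary.AllPairs using ([]; _∷_)
open import Data.List.Relation.Unary.Any using (here; there)
open import Data.List.Relation.Unary.Unique.Propositional using (Unique)
import Data.List.Relation.Unary.Unique.Propositional.Properties as Unique
open import Data.Nat.Base
open import Data.Nat.Induction using (<-rec)
open import Data.Nat.Properties
open import Data.Nat.Tactic.RingSolver using (solve-∀)
open import Data.Product.Base using (Σ-syntax; ∃₂; ∃-syntax; _×_; _,_; proj₁; proj₂)
open import Data.Rational.Base as ℚ using (0ℚ; 1ℚ)
import Data.Rational.Properties as ℚ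
open import Data.Rational.Unnormalised.Base as ℚᵘ using (mkℚᵘ; *≤*; *<*)
import Data.Rational.Unnormalised.Properties as ℚᵘ
open import Data.Sum.Base using (inj₁; inj₂)
open import Data.Unit.Base using (tt)
open import Data.Vec.Base as Vec using (Vec; []; _∷_; _∷ʳ_; initLast)
open import Data.Vec.Properties using (foldl-∷ʳ; map-∷ʳ; lookup-map)
open import Data.Vec.Relation.Binary.Pointwise.Inductive as Pointwise using (Pointwise; []; _∷_)
open import Function.Base using (_∘_)
open import Function.Bundles using (Equivalence)
open import Level using (0ℓ)
open import Relation.Binary.Construct.Closure.ReflexiveTransitive as Star using (Star; ε; _◅_; _◅◅_)
open import Relation.Binary.Construct.Closure.Symmetric using (fwd; bwd)
open import Relation.Binary.PropositionalEquality
open import Relation.Binary.Rewriting using (IsNormalForm)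
open import Relation.Nullary.Negation.Core using (¬_; contradiction)
open import Relation.Unary using (Pred)

-- Head reduction and standardisation

Pointwise-∷ʳ : {A : Set} {_∼_ : A → A → Set} {n : ℕ} {as bs : Vec A n} {a b : A} →
  Pointwise _∼_ as bs → a ∼ b → Pointwise _∼_ (as ∷ʳ a) (bs ∷ʳ b)
Pointwise-∷ʳ []       q = q ∷ []
Pointwise-∷ʳ (p ∷ ps) q = p ∷ Pointwise-∷ʳ ps q

module _ {𝓑 : Basis} {V : Set} where
  open Basis 𝓑

  infixl 7 _▹_
  infix 4 _⟶ₕ_ _↠ₕ_ _⇒_ _⇒ᵢ_ _↠⇒ᵢ_ _⇓_ _⇓ᵢ_

  -- Spines grow at the last argument and can be matched on, whereas the left fold `applyAll`
  -- cannot. The index counts the arguments, so a head redex is a spine of length `arity X`.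
  data Spine : Term 𝓑 V → Primitive → ℕ → Set where
    head : ∀ {X} → Spine (prim X) X 0
    _▹_  : ∀ {P X k} → Spine P X k → (Q : Term 𝓑 V) → Spine (P · Q) X (suc k)

  args : ∀ {P X k} → Spine P X k → Vec (Term 𝓑 V) k
  args head    = []
  args (s ▹ Q) = args s ∷ʳ Q

  spine-head : ∀ {P X Y k l} → Spine P X k → Spine P Y l → X ≡ Y
  spine-head head    head     = refl
  spine-head (s ▹ _) (s′ ▹ _) = spine-head s s′

  spine-length : ∀ {P X Y k l} → Spine P X k → Spine P Y l → k ≡ l
  spine-length head    head     = refl
  spine-length (s ▹ _) (s′ ▹ _) = cong suc (spine-length s s′)

  spine-irrelevant : ∀ {P X k} (s s′ : Spine P X k) → s ≡ s′
  spine-irrelevant head    head     = refl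
  spine-irrelevant (s ▹ Q) (s′ ▹ _) = cong (_▹ Q) (spine-irrelevant s s′)

  spine-saturated : ∀ {P X Y k} → Spine P X k → Spine P Y (arity Y) → k ≡ arity X
  spine-saturated s s′ with refl ← spine-head s s′ = spine-length s s′

  contractum : ∀ {P X} → Spine P X (arity X) → Term 𝓑 V
  contractum {X = X} s = instantiate (rhs X) (args s)

  data _⟶ₕ_ : Term 𝓑 V → Term 𝓑 V → Set where
    contract : ∀ {P X} (s : Spine P X (arity X)) → P ⟶ₕ contractum s
    appˡ     : ∀ {P P′} Q → P ⟶ₕ P′ → P · Q ⟶ₕ P′ · Q

  _↠ₕ_ : Term 𝓑 V → Term 𝓑 V → Set
  _↠ₕ_ = Star _⟶ₕ_

  ↠ₕ-appˡ : ∀ {P P′} Q → P ↠ₕ P′ → P · Q ↠ₕ P′ · Q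
  ↠ₕ-appˡ Q = Star.gmap (_· Q) (appˡ Q)

  head-redex-arity : ∀ {P P′ X k} → Spine P X k → P ⟶ₕ P′ → arity X ≤ k
  head-redex-arity s       (contract s′) = ≤-reflexive (sym (spine-saturated s s′))
  head-redex-arity (s ▹ _) (appˡ _ h)    = m≤n⇒m≤1+n (head-redex-arity s h)

  function-irreducible : ∀ {P P′ Q X} → Spine (P · Q) X (arity X) → ¬ P ⟶ₕ P′
  function-irreducible {P} {P′} {Q} {X} s h = go s refl
    where
    -- Matching on the spine needs a variable index, so `arity X` becomes `k` together with an
    -- equation.
    go : ∀ {k} → Spine (P · Q) X k → k ≢ arity X
    go (s ▹ _) eq = <⇒≢ (s≤s (head-redex-arity s h)) (sym eq)

  ⟶ₕ-deterministic : ∀ {P Q R} → P ⟶ₕ Q → P ⟶ₕ R → Q ≡ R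
  ⟶ₕ-deterministic (contract s) (contract s′)
    with refl ← spine-head s s′ with refl ← spine-irrelevant s s′ = refl
  ⟶ₕ-deterministic (contract s) (appˡ _ h)   = contradiction h (function-irreducible s)
  ⟶ₕ-deterministic (appˡ _ h)   (contract s) = contradiction h (function-irreducible s)
  ⟶ₕ-deterministic (appˡ Q h)   (appˡ _ h′)  = cong (_· Q) (⟶ₕ-deterministic h h′)

  -- ⇒ᵢ is the internal part of parallel reduction ⇒: no redex on the head spine
  -- is contracted. Splitting red into ⇒ᵢ followed by one contraction avoids
  -- mentioning the vector of arguments.
  mutual
    data _⇒_ : Term 𝓑 V → Term 𝓑 V → Set where
      prim : ∀ X → prim X ⇒ prim X
      var  : ∀ v → var v ⇒ var v
      _·_  : ∀ {P P′ Q Q′} → P ⇒ P′ → Q ⇒ Q′ → P · Q ⇒ P′ · Q′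
      red  : ∀ {P P′ X} → P ⇒ᵢ P′ → (s : Spine P′ X (arity X)) → P ⇒ contractum s

    data _⇒ᵢ_ : Term 𝓑 V → Term 𝓑 V → Set where
      prim : ∀ X → prim X ⇒ᵢ prim X
      var  : ∀ v → var v ⇒ᵢ var v
      _·_  : ∀ {P P′ Q Q′} → P ⇒ᵢ P′ → Q ⇒ Q′ → P · Q ⇒ᵢ P′ · Q′

  _↠⇒ᵢ_ : Term 𝓑 V → Term 𝓑 V → Set
  P ↠⇒ᵢ R = ∃[ Q ] P ↠ₕ Q × Q ⇒ᵢ R

  ⇒ᵢ⇒⇒ : ∀ {P Q} → P ⇒ᵢ Q → P ⇒ Q
  ⇒ᵢ⇒⇒ (prim X) = prim X
  ⇒ᵢ⇒⇒ (var v)  = var v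
  ⇒ᵢ⇒⇒ (p · q)  = ⇒ᵢ⇒⇒ p · q

  ⇒ᵢ-refl : ∀ P → P ⇒ᵢ P
  ⇒ᵢ-refl (prim X) = prim X
  ⇒ᵢ-refl (var v)  = var v
  ⇒ᵢ-refl (P · Q)  = ⇒ᵢ-refl P · ⇒ᵢ⇒⇒ (⇒ᵢ-refl Q)

  ⇒-refl : ∀ P → P ⇒ P
  ⇒-refl P = ⇒ᵢ⇒⇒ (⇒ᵢ-refl P)

  instantiate-⇒ : ∀ {m} (M : RHS m) {Ns Ns′ : Vec (Term 𝓑 V) m} →
    Pointwise _⇒_ Ns Ns′ → instantiate M Ns ⇒ instantiate M Ns′
  instantiate-⇒ (arg i) ps = Pointwise.lookup ps i
  instantiate-⇒ (M · N) ps = instantiate-⇒ M ps · instantiate-⇒ N ps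

  -- Only the leftmost leaf of `M` comes to the head and has to be factored; at every other leaf the
  -- parallel step itself suffices.
  instantiate-↠⇒ᵢ : ∀ {m} (M : RHS m) {Ns Ns′ : Vec (Term 𝓑 V) m} →
    Pointwise (λ P P′ → P ⇒ P′ × P ↠⇒ᵢ P′) Ns Ns′ → instantiate M Ns ↠⇒ᵢ instantiate M Ns′
  instantiate-↠⇒ᵢ (arg i) ps = proj₂ (Pointwise.lookup ps i)
  instantiate-↠⇒ᵢ (M · N) ps =
    let (_ , hs , p) = instantiate-↠⇒ᵢ M ps
    in _ , ↠ₕ-appˡ _ hs , p · instantiate-⇒ N (Pointwise.map proj₁ ps)

  spine-⇒ᵢ : ∀ {P P′ X k} → P ⇒ᵢ P′ → (s : Spine P X k) →
    Σ[ s′ ∈ Spine P′ X k ] Pointwise _⇒_ (args s) (args s′)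
  spine-⇒ᵢ (prim _) head    = head , []
  spine-⇒ᵢ (p · q)  (s ▹ _) =
    let (s′ , ps) = spine-⇒ᵢ p s in s′ ▹ _ , Pointwise-∷ʳ ps q

  mutual
    -- In the case `red` the redex is present before the internal step already, so it is contracted
    -- first and the steps inside its arguments follow.
    ⇒⇒↠⇒ᵢ : ∀ {P P′} → P ⇒ P′ → P ↠⇒ᵢ P′
    ⇒⇒↠⇒ᵢ (prim X) = _ , ε , prim X
    ⇒⇒↠⇒ᵢ (var v)  = _ , ε , var v
    ⇒⇒↠⇒ᵢ (p · q)  = let (_ , hs , p′) = ⇒⇒↠⇒ᵢ p in _ , ↠ₕ-appˡ _ hs , p′ · q
    ⇒⇒↠⇒ᵢ (red {X = X} p s′) =
      let (s , ps)     = spine-⇒ᵢ⁻ p s′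
          (_ , hs , q) = instantiate-↠⇒ᵢ (rhs X) ps
      in _ , contract s ◅ hs , q

    -- Internal steps keep the head and the number of arguments. The arguments are factored here,
    -- where their steps are visible subderivations, which keeps the recursion structural.
    spine-⇒ᵢ⁻ : ∀ {P P′ X k} → P ⇒ᵢ P′ → (s′ : Spine P′ X k) →
      Σ[ s ∈ Spine P X k ] Pointwise (λ Q Q′ → Q ⇒ Q′ × Q ↠⇒ᵢ Q′) (args s) (args s′)
    spine-⇒ᵢ⁻ (prim _) head     = head , []
    spine-⇒ᵢ⁻ (p · q)  (s′ ▹ _) =
      let (s , ps) = spine-⇒ᵢ⁻ p s′ in s ▹ _ , Pointwise-∷ʳ ps (q , ⇒⇒↠⇒ᵢ q)

  ⇒ᵢ-preserves-head-redex : ∀ {P P′ Q} → P ⇒ᵢ P′ → P ⟶ₕ Q → ∃[ Q′ ] P′ ⟶ₕ Q′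
  ⇒ᵢ-preserves-head-redex p       (contract s) = _ , contract (proj₁ (spine-⇒ᵢ p s))
  ⇒ᵢ-preserves-head-redex (p · q) (appˡ _ h)   =
    let (_ , h′) = ⇒ᵢ-preserves-head-redex p h in _ , appˡ _ h′

  -- An internal step creates no head redex, so the redex of `P′` has an ancestor in `P`.
  -- Contracting that one may copy arguments or bring one to the head, so the remaining step is
  -- parallel but not always internal.
  postpone : ∀ {P P′ R′} → P ⇒ᵢ P′ → P′ ⟶ₕ R′ → ∃[ R ] P ⟶ₕ R × R ⇒ R′
  postpone p (contract {X = X} s′) =
    let (s , ps) = spine-⇒ᵢ⁻ p s′
    in _ , contract s , instantiate-⇒ (rhs X) (Pointwise.map proj₁ ps)
  postpone (p · q) (appˡ _ h) = let (_ , h′ , p′) = postpone p h in _ , appˡ _ h′ , p′ · q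

  standardise : ∀ {P P′ R′} → P ⇒ P′ → P′ ↠ₕ R′ → ∃[ R ] P ↠ₕ R × R ⇒ᵢ R′
  standardise p ε = ⇒⇒↠⇒ᵢ p
  standardise p (h ◅ hs) =
    let (_ , hs₁ , p₁) = ⇒⇒↠⇒ᵢ p
        (_ , h₂ , p₂)  = postpone p₁ h
        (_ , hs₃ , p₃) = standardise p₂ hs
    in _ , hs₁ ◅◅ h₂ ◅ hs₃ , p₃

  -- Along the head spine, `red` needs a saturated prefix, and all prefixes of this spine are too
  -- short.
  unsaturated-⇒ᵢ : ∀ {P P′ X k} → Spine P X k → k < arity X → P ⇒ P′ → P ⇒ᵢ P′
  unsaturated-⇒ᵢ head    k< (prim X)   = prim X
  unsaturated-⇒ᵢ (s ▹ _) k< (p · q)    = unsaturated-⇒ᵢ s (<-trans (n<1+n _) k<) p · q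
  unsaturated-⇒ᵢ s       k< (red p s′) =
    contradiction (spine-saturated s (proj₁ (spine-⇒ᵢ⁻ p s′))) (<⇒≢ k<)

  function-⇒ᵢ : ∀ {P P′ Q X} → Spine (P · Q) X (arity X) → P ⇒ P′ → P ⇒ᵢ P′
  function-⇒ᵢ {P} {P′} {Q} {X} s p = go s refl
    where
    go : ∀ {k} → Spine (P · Q) X k → k ≡ arity X → P ⇒ᵢ P′
    go (s ▹ _) eq = unsaturated-⇒ᵢ s (≤-reflexive eq) p

  prim-irreducible : ∀ {X P} → ¬ prim X ⟶ₕ P
  prim-irreducible {X} (contract s) with refl ← spine-head s head =
    contradiction (spine-length s head) (>⇒≢ (arity≥1 X))

  var-irreducible : ∀ {v P} → ¬ var v ⟶ₕ P
  var-irreducible (contract ())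

  contract-project : ∀ {P P′ X} (s : Spine P X (arity X)) → P ⇒ᵢ P′ →
    ∃[ N ] P′ ↠ₕ N × contractum s ⇒ N
  contract-project {X = X} s p =
    let (s′ , ps) = spine-⇒ᵢ p s in _ , contract s′ ◅ ε , instantiate-⇒ (rhs X) ps

  -- Either the parallel step contracts the head redex itself, and by determinism `N` has no step
  -- left to make, or the redex survives in `N` and is contracted there.
  project₁ : ∀ {M M₁ N} → M ⟶ₕ M₁ → M ⇒ N → ∃[ N₁ ] N ↠ₕ N₁ × M₁ ⇒ N₁
  project₁ h            (prim _)   = contradiction h prim-irreducible
  project₁ h            (var _)    = contradiction h var-irreducible
  project₁ (contract s) (p · q)    = contract-project s (function-⇒ᵢ s p · q)
  project₁ (appˡ _ h)   (p · q)    =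
    let (_ , hs , p′) = project₁ h p in _ , ↠ₕ-appˡ _ hs , p′ · q
  project₁ h            (red p s′) with spine-⇒ᵢ⁻ p s′
  ... | s , ps with refl ← ⟶ₕ-deterministic (contract s) h =
    _ , ε , instantiate-⇒ (rhs _) (Pointwise.map proj₁ ps)

  project : ∀ {M M₁ N} → M ↠ₕ M₁ → M ⇒ N → ∃[ N₁ ] N ↠ₕ N₁ × M₁ ⇒ N₁
  project ε        p = _ , ε , p
  project (h ◅ hs) p =
    let (_ , hs₁ , p₁) = project₁ h p
        (_ , hs₂ , p₂) = project hs p₁
    in _ , hs₁ ◅◅ hs₂ , p₂

  spine-applyAll : ∀ {m} X (Ns : Vec (Term 𝓑 V) m) →
    Σ[ s ∈ Spine (applyAll (prim X) Ns) X m ] args s ≡ Ns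
  spine-applyAll {zero}  X []  = head , refl
  spine-applyAll {suc m} X Ns with initLast Ns
  ... | Ns′ , N , refl rewrite foldl-∷ʳ (λ _ → Term 𝓑 V) _·_ (prim X) N Ns′ =
    let (s , eq) = spine-applyAll X Ns′ in s ▹ N , cong (_∷ʳ N) eq

  applyAll-args : ∀ {P X k} (s : Spine P X k) → applyAll (prim X) (args s) ≡ P
  applyAll-args head            = refl
  applyAll-args {X = X} (s ▹ Q) =
    trans (foldl-∷ʳ (λ _ → Term 𝓑 V) _·_ (prim X) Q (args s)) (cong (_· Q) (applyAll-args s))

  ⟶⇒⇒ : ∀ {P Q} → P ⟶ Q → P ⇒ Q
  ⟶⇒⇒ (rule X Ns) =
    let (s , eq) = spine-applyAll X Ns
    in subst (λ As → applyAll (prim X) Ns ⇒ instantiate (rhs X) As) eq (red (⇒ᵢ-refl _) s)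
  ⟶⇒⇒ (appˡ R r) = ⟶⇒⇒ r · ⇒-refl R
  ⟶⇒⇒ (appʳ R r) = ⇒-refl R · ⟶⇒⇒ r

  ⟶ₕ⇒⟶ : ∀ {P Q} → P ⟶ₕ Q → P ⟶ Q
  ⟶ₕ⇒⟶ (contract {X = X} s) = subst (_⟶ contractum s) (applyAll-args s) (rule X (args s))
  ⟶ₕ⇒⟶ (appˡ Q h)           = appˡ Q (⟶ₕ⇒⟶ h)

  prim-normal : ∀ X → IsNormalForm (_⟶_ {𝓑} {V}) (prim X)
  prim-normal X (_ , r) = go r refl
    where
    go : ∀ {P Q : Term 𝓑 V} → P ⟶ Q → P ≢ prim X
    go (rule Y Ns) eq =
      prim-irreducible (subst (_⟶ₕ contractum s) eq (contract s))
      where s = proj₁ (spine-applyAll Y Ns)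

  -- Head normalisation, and evaluation to terms without primitives

  data HeadNormalising : Term 𝓑 V → Set where
    stop : ∀ {P} → (∀ {Q} → ¬ P ⟶ₕ Q) → HeadNormalising P
    step : ∀ {P Q} → P ⟶ₕ Q → HeadNormalising Q → HeadNormalising P

  headNormalising-↠ₕ⁻ : ∀ {P Q} → P ↠ₕ Q → HeadNormalising Q → HeadNormalising P
  headNormalising-↠ₕ⁻ hs n = Star.fold (λ P Q → HeadNormalising Q → HeadNormalising P)
    (λ h f n → step h (f n)) (λ n → n) hs n

  -- After factoring, only an internal step remains. It preserves head redexes, so a `stop` carries
  -- over; a head step of `Q` is moved in front of it by `postpone`, and the derivation for `Q`
  -- shrinks.
  headNormalising-⇒⁻ : ∀ {P Q} → P ⇒ Q → HeadNormalising Q → HeadNormalising P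
  headNormalising-⇒⁻ p n with ⇒⇒↠⇒ᵢ p
  headNormalising-⇒⁻ p (stop ¬h)  | _ , hs , p′ =
    headNormalising-↠ₕ⁻ hs (stop λ h → ¬h (proj₂ (⇒ᵢ-preserves-head-redex p′ h)))
  headNormalising-⇒⁻ p (step h n) | _ , hs , p′ =
    let (_ , h′ , q) = postpone p′ h
    in headNormalising-↠ₕ⁻ hs (step h′ (headNormalising-⇒⁻ q n))

  normal⇒headNormalising : ∀ {P Q} → IsNormalForm _⟶_ Q → Star _⟶_ P Q → HeadNormalising P
  normal⇒headNormalising nf ε        = stop λ h → nf (_ , ⟶ₕ⇒⟶ h)
  normal⇒headNormalising nf (r ◅ rs) =
    headNormalising-⇒⁻ (⟶⇒⇒ r) (normal⇒headNormalising nf rs)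

  -- P ⇓ t says that t, a term without primitives, is found by head reducing P and
  -- then recursively the arguments of its head variable. Unlike convertibility
  -- with t, this says how N x y z reaches x z (y z), and it survives substitution.
  mutual
    data _⇓ᵢ_ : Term 𝓑 V → Term 𝓑 V → Set where
      var : ∀ v → var v ⇓ᵢ var v
      _·_ : ∀ {P Q t u} → P ⇓ᵢ t → Q ⇓ u → P · Q ⇓ᵢ t · u

    data _⇓_ : Term 𝓑 V → Term 𝓑 V → Set where
      _then_ : ∀ {P Q t} → P ↠ₕ Q → Q ⇓ᵢ t → P ⇓ t

  ⇓ᵢ-spineless : ∀ {P t X k} → P ⇓ᵢ t → ¬ Spine P X k
  ⇓ᵢ-spineless (p · _) (s ▹ _) = ⇓ᵢ-spineless p s

  mutual
    ⇓ᵢ-⇒ : ∀ {P Q t} → P ⇒ Q → P ⇓ᵢ t → Q ⇓ᵢ t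
    ⇓ᵢ-⇒ (var v)    (var _) = var v
    ⇓ᵢ-⇒ (p · q)    (d · e) = ⇓ᵢ-⇒ p d · ⇓-⇒ q e
    ⇓ᵢ-⇒ (red p s′) d       = contradiction (proj₁ (spine-⇒ᵢ⁻ p s′)) (⇓ᵢ-spineless d)

    ⇓-⇒ : ∀ {P Q t} → P ⇒ Q → P ⇓ t → Q ⇓ t
    ⇓-⇒ p (hs then d) = let (_ , hs′ , p′) = project hs p in hs′ then ⇓ᵢ-⇒ p′ d

  mutual
    ⇓ᵢ-⇒⁻ : ∀ {P Q t} → P ⇒ᵢ Q → Q ⇓ᵢ t → P ⇓ᵢ t
    ⇓ᵢ-⇒⁻ (var v) (var _) = var v
    ⇓ᵢ-⇒⁻ (p · q) (d · e) = ⇓ᵢ-⇒⁻ p d · ⇓-⇒⁻ q e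

    ⇓-⇒⁻ : ∀ {P Q t} → P ⇒ Q → Q ⇓ t → P ⇓ t
    ⇓-⇒⁻ p (hs then d) = let (_ , hs′ , p′) = standardise p hs in hs′ then ⇓ᵢ-⇒⁻ p′ d

  -- Evaluation is invariant in both directions of a step, by standardisation against it and by
  -- projection along it. A conversion thus becomes a head reduction.
  ⇓-↔⁻ : ∀ {P Q t} → P ↔ Q → Q ⇓ t → P ⇓ t
  ⇓-↔⁻ ε            d = d
  ⇓-↔⁻ (fwd r ◅ rs) d = ⇓-⇒⁻ (⟶⇒⇒ r) (⇓-↔⁻ rs d)
  ⇓-↔⁻ (bwd r ◅ rs) d = ⇓-⇒ (⟶⇒⇒ r) (⇓-↔⁻ rs d)

-- Substitution for variables

module _ {𝓑 : Basis} {V W : Set} (σ : V → Term 𝓑 W) where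
  open Basis 𝓑

  substitute : Term 𝓑 V → Term 𝓑 W
  substitute (prim X) = prim X
  substitute (var v)  = σ v
  substitute (P · Q)  = substitute P · substitute Q

  substitute-instantiate : ∀ {m} (M : RHS m) (Ns : Vec (Term 𝓑 V) m) →
    instantiate M (Vec.map substitute Ns) ≡ substitute (instantiate M Ns)
  substitute-instantiate (arg i) Ns = lookup-map i substitute Ns
  substitute-instantiate (M · N) Ns =
    cong₂ _·_ (substitute-instantiate M Ns) (substitute-instantiate N Ns)

  spine-substitute : ∀ {P X k} (s : Spine P X k) →
    Σ[ s′ ∈ Spine (substitute P) X k ] args s′ ≡ Vec.map substitute (args s)
  spine-substitute head    = head , refl
  spine-substitute (s ▹ Q) =
    let (s′ , eq) = spine-substitute s
    in s′ ▹ substitute Q , trans (cong (_∷ʳ substitute Q) eq) (sym (map-∷ʳ substitute Q (args s)))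

  -- The head of a redex is a primitive, which no substitution alters.
  ⟶ₕ-substitute : ∀ {P Q} → P ⟶ₕ Q → substitute P ⟶ₕ substitute Q
  ⟶ₕ-substitute (contract {P} {X} s) =
    let (s′ , eq) = spine-substitute s
    in subst (substitute P ⟶ₕ_)
         (trans (cong (instantiate (rhs X)) eq) (substitute-instantiate (rhs X) (args s)))
         (contract s′)
  ⟶ₕ-substitute (appˡ Q h) = appˡ (substitute Q) (⟶ₕ-substitute h)

  ↠ₕ-substitute : ∀ {P Q} → P ↠ₕ Q → substitute P ↠ₕ substitute Q
  ↠ₕ-substitute = Star.gmap substitute ⟶ₕ-substitute

substitute-embed : {𝓑 : Basis} {V : Set} (σ : V → Combinator 𝓑) (N : Combinator 𝓑) →
  substitute σ (embed N) ≡ N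
substitute-embed σ (prim X) = refl
substitute-embed σ (P · Q)  = cong₂ _·_ (substitute-embed σ P) (substitute-embed σ Q)

-- Simulating K and S by head reduction

module _ {𝓑 : Basis} {N : Combinator 𝓑} (extK : ExtEqK 𝓑 N) where

  K-reduces : ∀ P Q → N · P · Q ↠ₕ P
  K-reduces P Q with ⇓-↔⁻ extK (ε then var x)
  ... | hs then var x =
    subst (λ M → M · P · Q ↠ₕ P) (substitute-embed σ N) (↠ₕ-substitute σ hs)
    where
    σ : Variable → Combinator 𝓑
    σ x = P
    σ y = Q
    σ z = Q

module _ {𝓑 : Basis} {N : Combinator 𝓑} (extS : ExtEqS 𝓑 N) where

  -- Evaluation reaches the head first, so the arguments are known only up to further head
  -- reduction. The first step is split off to guarantee progress in the loop of `Ω`.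
  S-reduces : ∀ A B C → ∃[ P ] ∃[ R ] ∃[ T ] ∃[ M ]
    N · A · B · C ⟶ₕ M × M ↠ₕ A · P · R × P ↠ₕ C × R ↠ₕ B · T × T ↠ₕ C
  S-reduces A B C with ⇓-↔⁻ extS (ε then ((var x · (ε then var z)) · (ε then (var y · (ε then var z)))))
  -- The empty reduction is impossible by shape: the function part `embed N · var x` would have to
  -- be the variable `x`.
  ... | (_◅_ {j = M} h hs) then ((_·_ {Q = P} (var x) (p then var z)) ·
          (_then_ {P = R} r (_·_ {Q = T} (var y) (t then var z)))) =
    substitute σ P , substitute σ R , substitute σ T , substitute σ M ,
    subst (λ L → L · A · B · C ⟶ₕ substitute σ M) (substitute-embed σ N) (⟶ₕ-substitute σ h) ,
    ↠ₕ-substitute σ hs , ↠ₕ-substitute σ p , ↠ₕ-substitute σ r , ↠ₕ-substitute σ t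
    where
    σ : Variable → Combinator 𝓑
    σ x = A
    σ y = B
    σ z = C

module _ {𝓑 : Basis} {S K : Combinator 𝓑} (extS : ExtEqS 𝓑 S) (extK : ExtEqK 𝓑 K) where

  I ω Ω : Combinator 𝓑
  I = S · K · K
  ω = S · I · I
  Ω = ω · ω

  I-reduces : ∀ P → I · P ↠ₕ P
  I-reduces P =
    let (_ , _ , _ , _ , h , hs , p , _) = S-reduces extS K K P
    in h ◅ hs ◅◅ K-reduces extK _ _ ◅◅ p

  -- Self-application copies the argument only up to head reduction, so the
  -- invariant of the loop is that the argument head-reduces to ω.
  ω-loops : ∀ {Q} → Q ↠ₕ ω → ∃₂ λ M R → ω · Q ⟶ₕ M × M ↠ₕ ω · R × R ↠ₕ ω
  ω-loops {Q} q =
    let (P , R , T , M , h , hs , p , r , t) = S-reduces extS I I Q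
    in M , R , h ,
       hs ◅◅ ↠ₕ-appˡ R (I-reduces P ◅◅ p ◅◅ q) ,
       r ◅◅ I-reduces T ◅◅ t ◅◅ q

  -- By determinism a derivation of `HeadNormalising` has to follow the loop. Every turn takes at
  -- least one step, so the derivation decreases for ever.
  loop-diverges : ∀ {M Q} → M ↠ₕ ω · Q → Q ↠ₕ ω → ¬ HeadNormalising M
  loop-diverges (h ◅ hs) q (stop ¬h) = ¬h h
  loop-diverges (h ◅ hs) q (step h′ n) with refl ← ⟶ₕ-deterministic h h′ = loop-diverges hs q n
  loop-diverges ε q n with ω-loops q | n
  ... | _ , _ , h , hs , r | stop ¬h = ¬h h
  ... | _ , _ , h , hs , r | step h′ n′ with refl ← ⟶ₕ-deterministic h h′ = loop-diverges hs r n′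

  KΩ-not-normalising : ∀ Q → ¬ 𝒲𝒩 𝓑 (K · Ω · Q)
  KΩ-not-normalising Q (_ , nf , rs) =
    loop-diverges (K-reduces extK Ω Q) ε (normal⇒headNormalising nf rs)

K-prim-normalising : {𝓑 : Basis} {K : Combinator 𝓑} → ExtEqK 𝓑 K →
  ∀ X Q → 𝒲𝒩 𝓑 (K · prim X · Q)
K-prim-normalising extK X Q =
  prim X , prim-normal X , Star.map ⟶ₕ⇒⟶ (K-reduces extK (prim X) Q)

-- This provides a normal form and makes all counts used as denominators bounded by a nonzero growth
-- factor.
some-primitive : {𝓑 : Basis} → Combinator 𝓑 → Basis.Primitive 𝓑
some-primitive (prim X) = X
some-primitive (P · _)  = some-primitive P

-- Counting combinators by size

-- The Cauchy product, the sum of `f i * g j` over i + j = n.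
conv : (ℕ → ℕ) → (ℕ → ℕ) → ℕ → ℕ
conv f g zero    = f 0 * g 0
conv f g (suc n) = f 0 * g (suc n) + conv (f ∘ suc) g n

conv-congˡ : ∀ {f f′} g n → (∀ i → i ≤ n → f i ≡ f′ i) → conv f g n ≡ conv f′ g n
conv-congˡ g zero    eq = cong (_* g 0) (eq 0 z≤n)
conv-congˡ g (suc n) eq =
  cong₂ _+_ (cong (_* g (suc n)) (eq 0 z≤n)) (conv-congˡ g n λ i i≤n → eq (suc i) (s≤s i≤n))

conv-sucʳ : ∀ f g n → conv f g (suc n) ≡ conv f (g ∘ suc) n + f (suc n) * g 0
conv-sucʳ f g zero    = refl
conv-sucʳ f g (suc n) = begin
  f 0 * g (2 + n) + conv (f ∘ suc) g (suc n)
    ≡⟨ cong (f 0 * g (2 + n) +_) (conv-sucʳ (f ∘ suc) g n) ⟩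
  f 0 * g (2 + n) + (conv (f ∘ suc) (g ∘ suc) n + f (2 + n) * g 0)
    ≡⟨ +-assoc (f 0 * g (2 + n)) _ _ ⟨
  f 0 * g (2 + n) + conv (f ∘ suc) (g ∘ suc) n + f (2 + n) * g 0 ∎
  where open ≡-Reasoning

conv-comm : ∀ f g n → conv f g n ≡ conv g f n
conv-comm f g zero    = *-comm (f 0) (g 0)
conv-comm f g (suc n) = begin
  f 0 * g (suc n) + conv (f ∘ suc) g n ≡⟨ cong₂ _+_ (*-comm (f 0) _) (conv-comm (f ∘ suc) g n) ⟩
  g (suc n) * f 0 + conv g (f ∘ suc) n ≡⟨ +-comm (g (suc n) * f 0) _ ⟩
  conv g (f ∘ suc) n + g (suc n) * f 0 ≡⟨ conv-sucʳ g f n ⟨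
  conv g f (suc n)                     ∎
  where open ≡-Reasoning

conv-*ˡ : ∀ a f g n → conv (λ i → a * f i) g n ≡ a * conv f g n
conv-*ˡ a f g zero    = *-assoc a (f 0) (g 0)
conv-*ˡ a f g (suc n) = begin
  a * f 0 * g (suc n) + conv (λ i → a * f (suc i)) g n
    ≡⟨ cong₂ _+_ (*-assoc a (f 0) _) (conv-*ˡ a (f ∘ suc) g n) ⟩
  a * (f 0 * g (suc n)) + a * conv (f ∘ suc) g n
    ≡⟨ *-distribˡ-+ a (f 0 * g (suc n)) _ ⟨
  a * (f 0 * g (suc n) + conv (f ∘ suc) g n) ∎
  where open ≡-Reasoning

-- In each term i + j = n, so the two weights add up to the constant `a + b + k * n`. Shifting `f`
-- in the induction moves one `k` into `a`.
conv-weighted : ∀ a b k f g n →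
  conv (λ i → (a + k * i) * f i) g n + conv f (λ j → (b + k * j) * g j) n ≡
  (a + b + k * n) * conv f g n
conv-weighted a b k f g zero    = base a b k (f 0) (g 0)
  where
  base : ∀ a b k p q → (a + k * 0) * p * q + p * ((b + k * 0) * q) ≡ (a + b + k * 0) * (p * q)
  base = solve-∀
conv-weighted a b k f g (suc n) = begin
  (a + k * 0) * f 0 * g (suc n) + conv (λ i → (a + k * suc i) * f (suc i)) g n
    + (f 0 * ((b + k * suc n) * g (suc n)) + Y)
    ≡⟨ cong (λ c → (a + k * 0) * f 0 * g (suc n) + c + (f 0 * ((b + k * suc n) * g (suc n)) + Y))
         (conv-congˡ g n λ i _ → cong (_* f (suc i)) (shift a k i)) ⟩
  (a + k * 0) * f 0 * g (suc n) + X + (f 0 * ((b + k * suc n) * g (suc n)) + Y)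
    ≡⟨ collect a b k n (f 0) (g (suc n)) X Y ⟩
  (a + b + k * suc n) * (f 0 * g (suc n)) + (X + Y)
    ≡⟨ cong ((a + b + k * suc n) * (f 0 * g (suc n)) +_) (conv-weighted (a + k) b k (f ∘ suc) g n) ⟩
  (a + b + k * suc n) * (f 0 * g (suc n)) + (a + k + b + k * n) * conv (f ∘ suc) g n
    ≡⟨ factor a b k n (f 0 * g (suc n)) _ ⟩
  (a + b + k * suc n) * (f 0 * g (suc n) + conv (f ∘ suc) g n) ∎
  where
  open ≡-Reasoning
  X = conv (λ i → (a + k + k * i) * f (suc i)) g n
  Y = conv (f ∘ suc) (λ j → (b + k * j) * g j) n
  shift : ∀ a k i → a + k * suc i ≡ a + k + k * i
  shift = solve-∀
  collect : ∀ a b k n p q X Y →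
    (a + k * 0) * p * q + X + (p * ((b + k * suc n) * q) + Y) ≡ (a + b + k * suc n) * (p * q) + (X + Y)
  collect = solve-∀
  factor : ∀ a b k n p C →
    (a + b + k * suc n) * p + (a + k + b + k * n) * C ≡ (a + b + k * suc n) * (p + C)
  factor = solve-∀

conv-self-weighted : ∀ a k f n →
  2 * conv (λ i → (a + k * i) * f i) f n ≡ (a + a + k * n) * conv f f n
conv-self-weighted a k f n = begin
  2 * X                                         ≡⟨ cong (X +_) (+-identityʳ X) ⟩
  X + X                                         ≡⟨ cong (X +_) (conv-comm _ f n) ⟩
  X + conv f (λ i → (a + k * i) * f i) n        ≡⟨ conv-weighted a a k f f n ⟩
  (a + a + k * n) * conv f f n                  ∎
  where
  open ≡-Reasoning
  X = conv (λ i → (a + k * i) * f i) f n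

module _ (c : ℕ → ℕ) (c-suc : ∀ n → c (suc n) ≡ conv c c n) where

  -- Multiplying the left factor of c ∗ c by i + 1 halves, by symmetry, to
  -- (n + 2) / 2 times c ∗ c; the recurrence below n turns the same sum into
  -- 4 c₀ times c ∗ c with left factors weighted by i + 1/2.
  catalan-recurrence : ∀ n → (2 + n) * c (suc n) ≡ c 0 * (2 + 4 * n) * c n
  catalan-recurrence = <-rec _ go
    where
    open ≡-Reasoning
    go : ∀ n → (∀ {m} → m < n → (2 + m) * c (suc m) ≡ c 0 * (2 + 4 * m) * c m) →
         (2 + n) * c (suc n) ≡ c 0 * (2 + 4 * n) * c n
    go zero    _  = trans (cong (2 *_) (c-suc 0)) (base (c 0))
      where
      base : ∀ r → 2 * (r * r) ≡ r * (2 + 4 * 0) * r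
      base = solve-∀
    go (suc m) ih = begin
      (3 + m) * c (2 + m)
        ≡⟨ cong₂ _*_ (weight m) (c-suc (suc m)) ⟩
      (1 + 1 + 1 * suc m) * conv c c (suc m)
        ≡⟨ conv-self-weighted 1 1 c (suc m) ⟨
      2 * ((1 + 1 * 0) * c 0 * c (suc m) + conv (λ i → (1 + 1 * suc i) * c (suc i)) c m)
        ≡⟨ cong (λ X → 2 * ((1 + 1 * 0) * c 0 * c (suc m) + X)) (begin
             conv (λ i → (1 + 1 * suc i) * c (suc i)) c m
               ≡⟨ conv-congˡ c m (λ i i≤m → trans (cong (_* c (suc i)) (index i))
                    (trans (ih (s≤s i≤m)) (*-assoc (c 0) _ _))) ⟩
             conv (λ i → c 0 * ((2 + 4 * i) * c i)) c m
               ≡⟨ conv-*ˡ (c 0) _ c m ⟩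
             c 0 * conv (λ i → (2 + 4 * i) * c i) c m ∎) ⟩
      2 * ((1 + 1 * 0) * c 0 * c (suc m) + c 0 * conv (λ i → (2 + 4 * i) * c i) c m)
        ≡⟨ double (c 0) (c (suc m)) _ ⟩
      c 0 * (2 * c (suc m) + 2 * conv (λ i → (2 + 4 * i) * c i) c m)
        ≡⟨ cong (λ X → c 0 * (2 * c (suc m) + X)) (conv-self-weighted 2 4 c m) ⟩
      c 0 * (2 * c (suc m) + (2 + 2 + 4 * m) * conv c c m)
        ≡⟨ cong (λ X → c 0 * (2 * c (suc m) + (2 + 2 + 4 * m) * X)) (c-suc m) ⟨
      c 0 * (2 * c (suc m) + (2 + 2 + 4 * m) * c (suc m))
        ≡⟨ collect (c 0) m (c (suc m)) ⟩
      c 0 * (2 + 4 * suc m) * c (suc m) ∎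
      where
      weight : ∀ m → 3 + m ≡ 1 + 1 + 1 * suc m
      weight = solve-∀
      index : ∀ i → 1 + 1 * suc i ≡ 2 + i
      index = solve-∀
      double : ∀ r p X → 2 * ((1 + 1 * 0) * r * p + r * X) ≡ r * (2 * p + 2 * X)
      double = solve-∀
      collect : ∀ r m p → r * (2 * p + (2 + 2 + 4 * m) * p) ≡ r * (2 + 4 * suc m) * p
      collect = solve-∀

  growth-step : ∀ n → c (suc n) ≤ 4 * c 0 * c n
  growth-step n = *-cancelˡ-≤ (2 + n) (begin
    (2 + n) * c (suc n)                     ≡⟨ catalan-recurrence n ⟩
    -- The slack 6 is 4 (n + 2) - (4 n + 2).
    c 0 * (2 + 4 * n) * c n                 ≤⟨ m≤m+n _ (6 * c 0 * c n) ⟩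
    c 0 * (2 + 4 * n) * c n + 6 * c 0 * c n ≡⟨ regroup (c 0) n (c n) ⟩
    (2 + n) * (4 * c 0 * c n)               ∎)
    where
    open ≤-Reasoning
    regroup : ∀ r n p → r * (2 + 4 * n) * p + 6 * r * p ≡ (2 + n) * (4 * r * p)
    regroup = solve-∀

  growth : ∀ d n → c (d + n) ≤ (4 * c 0) ^ d * c n
  growth zero    n = ≤-reflexive (sym (*-identityˡ (c n)))
  growth (suc d) n = begin
    c (suc d + n)                     ≤⟨ growth-step (d + n) ⟩
    4 * c 0 * c (d + n)               ≤⟨ *-monoʳ-≤ (4 * c 0) (growth d n) ⟩
    4 * c 0 * ((4 * c 0) ^ d * c n)   ≡⟨ *-assoc (4 * c 0) ((4 * c 0) ^ d) (c n) ⟨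
    (4 * c 0) ^ suc d * c n           ∎
    where open ≤-Reasoning

-- Enumerations without repetition

remove : {A : Set} {a : A} {as : List A} → a ∈ as →
  ∃[ bs ] length as ≡ suc (length bs) × (∀ {b} → b ∈ as → b ≢ a → b ∈ bs)
remove {as = _ ∷ as} (here refl) = as , refl , λ
  { (here eq) b≢a → contradiction eq b≢a ; (there b∈) _ → b∈ }
remove {as = a′ ∷ _} (there a∈) =
  let (bs , eq , f) = remove a∈
  in a′ ∷ bs , cong suc eq , λ { (here eq) _ → here eq ; (there b∈) b≢a → there (f b∈ b≢a) }

unique-⊆-length : {A : Set} {as bs : List A} → Unique as → as ⊆ bs → length as ≤ length bs
unique-⊆-length []         sub = z≤n
unique-⊆-length {bs = bs} (a∉ ∷ uniq) sub with remove (sub (here refl))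
... | bs′ , eq , f = subst (_ ≤_) (sym eq)
  (s≤s (unique-⊆-length uniq λ b∈ → f (sub (there b∈)) λ { refl → All.lookup a∉ b∈ refl }))

length-cartesianProductWith : {A B C : Set} (f : A → B → C) (as : List A) (bs : List B) →
  length (cartesianProductWith f as bs) ≡ length as * length bs
length-cartesianProductWith f []       bs = refl
length-cartesianProductWith f (a ∷ as) bs = trans (length-++ (map (f a) bs))
  (cong₂ _+_ (length-map (f a) bs) (length-cartesianProductWith f as bs))

module _ {𝓑 : Basis} where
  open Basis 𝓑

  private
    C = Combinator 𝓑

  ·-injective : {P P′ Q Q′ : C} → P · Q ≡ P′ · Q′ → P ≡ P′ × Q ≡ Q′
  ·-injective refl = refl , refl

  -- The recursion is that of `conv`, so lengths agree term by term; it shifts the left family only,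
  -- hence two families.
  products : (L R : ℕ → List C) → ℕ → List C
  products L R zero    = cartesianProductWith _·_ (L 0) (R 0)
  products L R (suc n) = cartesianProductWith _·_ (L 0) (R (suc n)) ++ products (L ∘ suc) R n

  length-products : ∀ L R n → length (products L R n) ≡ conv (length ∘ L) (length ∘ R) n
  length-products L R zero    = length-cartesianProductWith _·_ (L 0) (R 0)
  length-products L R (suc n) = trans (length-++ (cartesianProductWith _·_ (L 0) (R (suc n))))
    (cong₂ _+_ (length-cartesianProductWith _·_ (L 0) (R (suc n))) (length-products (L ∘ suc) R n))

  ∈-products⁻ : ∀ L R n {M} → M ∈ products L R n →
    ∃₂ λ P Q → ∃₂ λ i j → M ≡ P · Q × i + j ≡ n × P ∈ L i × Q ∈ R j
  ∈-products⁻ L R zero M∈ =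
    let (P , Q , P∈ , Q∈ , eq) = ∈-cartesianProductWith⁻ _·_ (L 0) (R 0) M∈
    in P , Q , 0 , 0 , eq , refl , P∈ , Q∈
  ∈-products⁻ L R (suc n) M∈ with ∈-++⁻ (cartesianProductWith _·_ (L 0) (R (suc n))) M∈
  ... | inj₁ M∈ˡ =
    let (P , Q , P∈ , Q∈ , eq) = ∈-cartesianProductWith⁻ _·_ (L 0) (R (suc n)) M∈ˡ
    in P , Q , 0 , suc n , eq , refl , P∈ , Q∈
  ... | inj₂ M∈ʳ =
    let (P , Q , i , j , eq , i+j≡n , P∈ , Q∈) = ∈-products⁻ (L ∘ suc) R n M∈ʳ
    in P , Q , suc i , j , eq , cong suc i+j≡n , P∈ , Q∈

  ∈-products⁺ : ∀ L R i j {P Q} → P ∈ L i → Q ∈ R j → P · Q ∈ products L R (i + j)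
  ∈-products⁺ L R zero    zero    P∈ Q∈ = ∈-cartesianProductWith⁺ _·_ P∈ Q∈
  ∈-products⁺ L R zero    (suc j) P∈ Q∈ = ∈-++⁺ˡ (∈-cartesianProductWith⁺ _·_ P∈ Q∈)
  ∈-products⁺ L R (suc i) j       P∈ Q∈ = ∈-++⁺ʳ (cartesianProductWith _·_ (L 0) (R (suc i + j)))
    (∈-products⁺ (L ∘ suc) R i j P∈ Q∈)

  -- Blocks for different i are disjoint because their left factors come from disjoint lists.
  products-unique : ∀ L R n → (∀ i → Unique (L i)) → (∀ {i j P} → P ∈ L i → P ∈ L j → i ≡ j) →
    (∀ j → Unique (R j)) → Unique (products L R n)
  products-unique L R zero    uL dL uR = Unique.cartesianProductWith⁺ _·_ ·-injective (uL 0) (uR 0)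
  products-unique L R (suc n) uL dL uR = Unique.++⁺
    (Unique.cartesianProductWith⁺ _·_ ·-injective (uL 0) (uR (suc n)))
    (products-unique (L ∘ suc) R n (uL ∘ suc) (λ p q → suc-injective (dL p q)) uR)
    disjoint
    where
    disjoint : Disjoint (cartesianProductWith _·_ (L 0) (R (suc n))) (products (L ∘ suc) R n)
    disjoint (M∈ˡ , M∈ʳ)
      with ∈-cartesianProductWith⁻ _·_ (L 0) (R (suc n)) M∈ˡ | ∈-products⁻ (L ∘ suc) R n M∈ʳ
    ... | _ , _ , P∈ , _ , refl | _ , _ , _ , _ , refl , _ , P∈′ , _ with () ← dL P∈ P∈′

  -- fuel only makes the recursion structural: any fuel ≥ n gives all combinators of size n.
  trees : (fuel n : ℕ) → List C
  trees fuel       zero    = map prim (allFin #primitives)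
  trees zero       (suc n) = []
  trees (suc fuel) (suc n) = products (trees fuel) (trees fuel) n

  trees-size : ∀ fuel n {P} → P ∈ trees fuel n → size P ≡ n
  trees-size zero       zero    P∈ with _ , _ , refl ← ∈-map⁻ prim P∈ = refl
  trees-size (suc fuel) zero    P∈ with _ , _ , refl ← ∈-map⁻ prim P∈ = refl
  trees-size (suc fuel) (suc n) P∈
    with _ , _ , i , j , refl , eq , p , q ← ∈-products⁻ (trees fuel) (trees fuel) n P∈ =
    cong suc (trans (cong₂ _+_ (trees-size fuel i p) (trees-size fuel j q)) eq)

  ∈-trees : ∀ fuel P → size P ≤ fuel → P ∈ trees fuel (size P)
  ∈-trees zero       (prim X) _  = ∈-map⁺ prim (∈-allFin X)
  ∈-trees (suc fuel) (prim X) _  = ∈-map⁺ prim (∈-allFin X)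
  ∈-trees (suc fuel) (P · Q)  le = ∈-products⁺ (trees fuel) (trees fuel) (size P) (size Q)
    (∈-trees fuel P (≤-trans (m≤m+n (size P) (size Q)) (s≤s⁻¹ le)))
    (∈-trees fuel Q (≤-trans (m≤n+m (size Q) (size P)) (s≤s⁻¹ le)))

  prim-injective : ∀ {X Y} → Term.prim {𝓑} {⊥} X ≡ prim Y → X ≡ Y
  prim-injective refl = refl

  trees-unique : ∀ fuel n → Unique (trees fuel n)
  trees-unique zero       zero    = Unique.map⁺ prim-injective (Unique.allFin⁺ #primitives)
  trees-unique (suc fuel) zero    = Unique.map⁺ prim-injective (Unique.allFin⁺ #primitives)
  trees-unique zero       (suc n) = []
  trees-unique (suc fuel) (suc n) = products-unique (trees fuel) (trees fuel) n
    (trees-unique fuel) (λ {i} {j} p q → trans (sym (trees-size fuel i p)) (trees-size fuel j q))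
    (trees-unique fuel)

  ofSize : ℕ → List C
  ofSize n = trees n n

  ofSize-unique : ∀ n → Unique (ofSize n)
  ofSize-unique n = trees-unique n n

  ∈-ofSize⁺ : ∀ {n P} → size P ≡ n → P ∈ ofSize n
  ∈-ofSize⁺ {P = P} refl = ∈-trees (size P) P ≤-refl

  ∈-ofSize⁻ : ∀ {n P} → P ∈ ofSize n → size P ≡ n
  ∈-ofSize⁻ {n} = trees-size n n

  count : ℕ → ℕ
  count n = length (ofSize n)

  -- The fuel differs on the two sides, so the lists are compared by mutual inclusion rather than by
  -- equality.
  count-suc : ∀ n → count (suc n) ≡ conv count count n
  count-suc n = trans (≤-antisym
      (unique-⊆-length (ofSize-unique (suc n)) to)
      (unique-⊆-length (products-unique ofSize ofSize n ofSize-unique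
        (λ {i} {j} p q → trans (sym (∈-ofSize⁻ {i} p)) (∈-ofSize⁻ {j} q)) ofSize-unique) from))
    (length-products ofSize ofSize n)
    where
    to : ofSize (suc n) ⊆ products ofSize ofSize n
    to {P} P∈ with P | ∈-ofSize⁻ {suc n} P∈
    ... | Q · R | refl = ∈-products⁺ ofSize ofSize (size Q) (size R)
      (∈-ofSize⁺ {size Q} refl) (∈-ofSize⁺ {size R} refl)
    from : products ofSize ofSize n ⊆ ofSize (suc n)
    from P∈ with ∈-products⁻ ofSize ofSize n P∈
    ... | _ , _ , i , j , refl , refl , p , q =
      ∈-ofSize⁺ (cong suc (cong₂ _+_ (∈-ofSize⁻ {i} p) (∈-ofSize⁻ {j} q)))

  module _ (F : C) where

    image : ℕ → List C
    image m = map (F ·_) (ofSize m)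

    image-unique : ∀ m → Unique (image m)
    image-unique m = Unique.map⁺ (λ eq → proj₂ (·-injective eq)) (ofSize-unique m)

    length-image : ∀ m → length (image m) ≡ count m
    length-image m = length-map (F ·_) (ofSize m)

    ∈-image⁻ : ∀ {m P} → P ∈ image m → ∃[ Q ] P ≡ F · Q × size P ≡ suc (size F) + m
    ∈-image⁻ {m} P∈ with ∈-map⁻ (F ·_) P∈
    ... | Q , Q∈ , refl = Q , refl , cong (λ s → suc (size F + s)) (∈-ofSize⁻ {m} Q∈)

  count-complete : ∀ {n b} → Count (𝒞 𝓑) n b → b ≡ count n
  count-complete {n} (Ps , uniq , char , refl) = ≤-antisym
    (unique-⊆-length uniq λ {P} P∈ → ∈-ofSize⁺ (proj₂ (Equivalence.to (char P) P∈)))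
    (unique-⊆-length (ofSize-unique n) λ {P} P∈ → Equivalence.from (char P) (tt , ∈-ofSize⁻ {n} P∈))

  -- Applying `F` adds `suc (size F)` to the size, and each unit of size costs a growth factor of at
  -- most `4 * count 0`.
  dilution : C → ℕ
  dilution F = (4 * count 0) ^ suc (size F)

  count-diluted : ∀ F {n} → suc (size F) ≤ n → count n ≤ dilution F * count (n ∸ suc (size F))
  count-diluted F {n} d≤n =
    subst (λ k → count k ≤ dilution F * count (n ∸ suc (size F))) (m+[n∸m]≡n d≤n)
      (growth count count-suc (suc (size F)) (n ∸ suc (size F)))

  dilution-nonZero : Primitive → ∀ F → NonZero (dilution F)
  dilution-nonZero X F = m^n≢0 (4 * count 0) (suc (size F)) {{m*n≢0 4 (count 0) {{_}} {{nz}}}}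
    where
    nz : NonZero (count 0)
    nz = >-nonZero (∈-length (∈-ofSize⁺ {0} {prim X} refl))

  module _ (A : Pred C 0ℓ) (F : C) where

    private
      d = suc (size F)

    count-lower : (∀ Q → A (F · Q)) →
      ∀ {n a} → d ≤ n → Count A n a → count n ≤ dilution F * a
    count-lower inA {n} d≤n (Ps , uniq , char , refl) = ≤-trans (count-diluted F d≤n)
      (*-monoʳ-≤ (dilution F) (subst (_≤ length Ps) (length-image F (n ∸ d))
        (unique-⊆-length (image-unique F (n ∸ d)) sub)))
      where
      sub : image F (n ∸ d) ⊆ Ps
      sub {P} P∈ with ∈-image⁻ F {n ∸ d} P∈
      ... | Q , refl , eq = Equivalence.from (char P) (inA Q , trans eq (m+[n∸m]≡n d≤n))

    -- The elements of `A` and the terms `F · Q` are disjoint among all terms of size `n`. The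
    -- inequality is a / c ≤ 1 - 1/D, with c = `count n` and D the dilution, cleared of fractions
    -- and subtraction.
    count-upper : (∀ Q → ¬ A (F · Q)) →
      ∀ {n a} → d ≤ n → Count A n a → dilution F * a + count n ≤ dilution F * count n
    count-upper notA {n} d≤n (Ps , uniq , char , refl) = begin
      dilution F * length Ps + count n
        ≤⟨ +-monoʳ-≤ (dilution F * length Ps) (count-diluted F d≤n) ⟩
      dilution F * length Ps + dilution F * count (n ∸ d)
        ≡⟨ *-distribˡ-+ (dilution F) (length Ps) _ ⟨
      dilution F * (length Ps + count (n ∸ d))
        ≡⟨ cong (λ l → dilution F * (length Ps + l)) (length-image F (n ∸ d)) ⟨
      dilution F * (length Ps + length (image F (n ∸ d)))
        ≡⟨ cong (dilution F *_) (length-++ Ps) ⟨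
      dilution F * length (Ps ++ image F (n ∸ d))
        ≤⟨ *-monoʳ-≤ (dilution F) (unique-⊆-length
             (Unique.++⁺ uniq (image-unique F (n ∸ d)) disjoint) sub) ⟩
      dilution F * count n ∎
      where
      open ≤-Reasoning
      disjoint : Disjoint Ps (image F (n ∸ d))
      disjoint {P} (P∈ , P∈′) with ∈-image⁻ F {n ∸ d} P∈′
      ... | Q , refl , _ = notA Q (proj₁ (Equivalence.to (char P) P∈))
      sub : Ps ++ image F (n ∸ d) ⊆ ofSize n
      sub {P} P∈ with ∈-++⁻ Ps P∈
      ... | inj₁ P∈ˡ = ∈-ofSize⁺ (proj₂ (Equivalence.to (char P) P∈ˡ))
      ... | inj₂ P∈ʳ with ∈-image⁻ F {n ∸ d} P∈ʳ
      ...   | _ , _ , eq = ∈-ofSize⁺ (trans eq (m+[n∸m]≡n d≤n))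

-- From counts to densities

-- Since `ℚ./` reduces to lowest terms, the comparison passes to unnormalised fractions, where it is
-- cross-multiplication.
/-mono-≤ : ∀ {a b c d} .{{_ : NonZero b}} .{{_ : NonZero d}} →
  a * d ≤ c * b → (ℤ.+ a) ℚ./ b ℚ.≤ (ℤ.+ c) ℚ./ d
/-mono-≤ {a} {suc b} {c} {suc d} le = ℚ.toℚᵘ-cancel-≤
  (ℚᵘ.≤-respˡ-≃ (ℚᵘ.≃-sym (ℚ.toℚᵘ-fromℚᵘ (mkℚᵘ (ℤ.+ a) b)))
    (ℚᵘ.≤-respʳ-≃ (ℚᵘ.≃-sym (ℚ.toℚᵘ-fromℚᵘ (mkℚᵘ (ℤ.+ c) d)))
      (*≤* (subst₂ ℤ._≤_ (ℤ.pos-* a (suc d)) (ℤ.pos-* c (suc b)) (ℤ.+≤+ le)))))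

/-mono-< : ∀ {a b c d} .{{_ : NonZero b}} .{{_ : NonZero d}} →
  a * d < c * b → (ℤ.+ a) ℚ./ b ℚ.< (ℤ.+ c) ℚ./ d
/-mono-< {a} {suc b} {c} {suc d} lt = ℚ.toℚᵘ-cancel-<
  (ℚᵘ.<-respˡ-≃ (ℚᵘ.≃-sym (ℚ.toℚᵘ-fromℚᵘ (mkℚᵘ (ℤ.+ a) b)))
    (ℚᵘ.<-respʳ-≃ (ℚᵘ.≃-sym (ℚ.toℚᵘ-fromℚᵘ (mkℚᵘ (ℤ.+ c) d)))
      (*<* (subst₂ ℤ._<_ (ℤ.pos-* a (suc d)) (ℤ.pos-* c (suc b)) (ℤ.+<+ lt)))))

module _ {𝓑 : Basis} (X : Basis.Primitive 𝓑) (A : Pred (Combinator 𝓑) 0ℓ) (F : Combinator 𝓑) where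

  private
    D = dilution F

    instance
      D-nonZero : NonZero D
      D-nonZero = dilution-nonZero X F

  liminf-positive : (∀ Q → A (F · Q)) → 0ℚ <liminf ratio A (𝒞 𝓑)
  liminf-positive inA = suc (size F) , (ℤ.+ 1) ℚ./ D , /-mono-< {0} {1} {1} {D} z<s , bound
    where
    bound : ∀ n → n ≥ suc (size F) → ∀ t → ratio A (𝒞 𝓑) n t → (ℤ.+ 1) ℚ./ D ℚ.≤ t
    bound n d≤n _ (a , b , nz , countA , count𝒞 , refl) with refl ← count-complete count𝒞 =
      /-mono-≤ {1} {D} {a} {b} {{D-nonZero}} {{nz}} (begin
        1 * b ≡⟨ *-identityˡ b ⟩
        b     ≤⟨ count-lower A F inA d≤n countA ⟩
        D * a ≡⟨ *-comm D a ⟩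
        a * D ∎)
      where open ≤-Reasoning

  limsup-below-1 : (∀ Q → ¬ A (F · Q)) → limsup ratio A (𝒞 𝓑) < 1ℚ
  -- The bound `pred D / D` is 1 - 1/D; the threshold is the least size of a term `F · Q`.
  limsup-below-1 notA = suc (size F) , (ℤ.+ pred D) ℚ./ D ,
    /-mono-< {pred D} {D} {1} {1} pred-D< , bound
    where
    open ≤-Reasoning
    pred-D< : pred D * 1 < 1 * D
    pred-D< = begin-strict
      pred D * 1 ≡⟨ *-identityʳ (pred D) ⟩
      pred D     <⟨ ≤-reflexive (suc-pred D) ⟩
      D          ≡⟨ *-identityˡ D ⟨
      1 * D      ∎
    bound : ∀ n → n ≥ suc (size F) → ∀ t → ratio A (𝒞 𝓑) n t → t ℚ.≤ (ℤ.+ pred D) ℚ./ D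
    bound n d≤n _ (a , b , nz , countA , count𝒞 , refl) with refl ← count-complete count𝒞 =
      /-mono-≤ {a} {b} {pred D} {D} {{nz}} (+-cancelʳ-≤ b (a * D) (pred D * b) (begin
        a * D + b        ≡⟨ cong (_+ b) (*-comm a D) ⟩
        D * a + b        ≤⟨ count-upper A F notA d≤n countA ⟩
        D * b            ≡⟨ cong (_* b) (suc-pred D) ⟨
        b + pred D * b   ≡⟨ +-comm b _ ⟩
        pred D * b + b   ∎))

theorem18 : (𝓑 : Basis) → TuringComplete 𝓑 →
    (0ℚ <liminf ratio (𝒲𝒩 𝓑) (𝒞 𝓑)) × (limsup ratio (𝒲𝒩 𝓑) (𝒞 𝓑) < 1ℚ)
theorem18 𝓑 ((S , extS) , (K , extK)) =
  liminf-positive X (𝒲𝒩 𝓑) (K · prim X) (K-prim-normalising extK X) ,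
  limsup-below-1 X (𝒲𝒩 𝓑) (K · Ω extS extK) (KΩ-not-normalising extS extK)
  where X = some-primitive K
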